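{- Let $m \geq 1$ and $n \geq 1$ be integers. The generating function of the statistic $\mathtt{pinv}$ on $\mathbb{U}_m \wr \mathfrak{S}_n$ is $$\sum_{\pi \in \mathbb{U}_m \wr \mathfrak{S}_n} q^{\mathtt{pinv}\,\pi} = \prod_{i=1}^n [mi]_q.$$
   Context: $\mathfrak{S}_n$ is the symmetric group on $[n]=\{1,\dots,n\}$, $\mathbb{U}_m$ is the group of $m$-th roots of unity, and $\mathbb{U}_m \wr \mathfrak{S}_n$ is their wreath product (the colored permutation group of $m$ colors and $n$ elements). An element $\pi \in \mathbb{U}_m \wr \mathfrak{S}_n$ is represented as $\pi = \begin{pmatrix} 1 & 2 & \dots & n\\ \zeta_{k_1}\sigma(1) & \zeta_{k_2}\sigma(2) & \dots & \zeta_{k_n}\sigma(n)\end{pmatrix}$ with $\sigma \in \mathfrak{S}_n$, $\zeta_{k_j} = e^{2\pi \sqrt{ -1}\, k_j/m}$ and $k_j \in \{0,1,\dots,m-1\}$; thus $\pi$ amounts to a pair consisting of $\sigma\in\mathfrak{S}_n$ and $(k_1,\dots,k_n)\in\{0,\dots,m-1\}^n$. For $i \in [n]$, the number of $i$-pseudoinversions of $\pi$ is $$\mathtt{pinv}_i\,\pi := k_i(n-i+1) + \big|\{j \in \{i+1,\dots,n\} \mid \sigma(i) > \sigma(j)\}\big|,$$ and the number of pseudoinversions of $\pi$ is $\mathtt{pinv}\,\pi := \sum_{i=1}^n \mathtt{pinv}_i\,\pi$. Here $q$ is an indeterminate and $[i]_q := 1 + q + \dots + q^{i-1}$ denotes the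 $q$-analog of the positive integer $i$. -}

module Defs where

open import Algebra.Bundles using (RawSemiring)
import Algebra.Definitions.RawSemiring as RawSemiringDefinitions
open import Data.Fin.Base using (Fin; zero; suc; toℕ; punchIn; combine; remQuot; finToFun; funToFin)
open import Data.Fin.Permutation as Perm using (Permutation′; _⟨$⟩ʳ_)
open import Data.Fin.Properties using (_<?_; punchIn-injective; remQuot-combine; combine-remQuot; finToFun-funToFin; funToFin-finToFin)
open import Data.Integer.Base as ℤ using (ℤ; 0ℤ; 1ℤ)
open import Data.List.Base using (List; []; _∷_; allFin; filter; length; map)
open import Data.Nat.Base as ℕ using (ℕ; zero; suc; _!)
open import Data.Product.Base using (_×_; _,_; proj₁; proj₂)
open import Function.Base using (_∘_)
open import Function.Bundles using (Inverse)
open import Level using (0ℓ)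
open import Relation.Binary.Bundles using (Setoid)
open import Relation.Binary.PropositionalEquality using (_≡_; _≗_; refl; sym; trans; cong; cong₂; setoid; module ≡-Reasoning)
open import Relation.Nullary.Decidable using (_×-dec_)

------------------------------------------------------------------------
-- ℤ[q]

-- a₀ ∷ a₁ ∷ … ∷ aₙ ∷ [] is a₀ + a₁ q + … + aₙ qⁿ.  Trailing zeros are
-- allowed, so equality is coefficientwise rather than _≡_.
Polynomial : Set
Polynomial = List ℤ

coeff : Polynomial → ℕ → ℤ
coeff []      _       = 0ℤ
coeff (a ∷ _) zero    = a
coeff (_ ∷ p) (suc k) = coeff p k

infix  4 _≈ₚ_
infixl 6 _+ₚ_
infixl 7 _*ₚ_

_≈ₚ_ : Polynomial → Polynomial → Set
p ≈ₚ r = ∀ k → coeff p k ≡ coeff r k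

_+ₚ_ : Polynomial → Polynomial → Polynomial
[]      +ₚ r       = r
(a ∷ p) +ₚ []      = a ∷ p
(a ∷ p) +ₚ (b ∷ r) = (a ℤ.+ b) ∷ (p +ₚ r)

-- (a + q p) r = a r + q (p r)
_*ₚ_ : Polynomial → Polynomial → Polynomial
[]      *ₚ r = []
(a ∷ p) *ₚ r = map (a ℤ.*_) r +ₚ (0ℤ ∷ (p *ₚ r))

ℤ[q] : RawSemiring 0ℓ 0ℓ
ℤ[q] = record
  { Carrier = Polynomial
  ; _≈_     = _≈ₚ_
  ; _+_     = _+ₚ_
  ; _*_     = _*ₚ_
  ; 0#      = []
  ; 1#      = 1ℤ ∷ []
  }

module ℤ[q] where
  open RawSemiring ℤ[q] public using (_≈_; _+_; _*_; 0#; 1#)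
  open RawSemiringDefinitions ℤ[q] public using (sum; product; _^_)

q : Polynomial
q = 0ℤ ∷ 1ℤ ∷ []

[_]q : ℕ → Polynomial
[ i ]q = ℤ[q].sum {i} λ j → q ℤ[q].^ toℕ j

------------------------------------------------------------------------
-- Colored permutations

-- The element of [n] = {1,…,n} that i : Fin n stands for.
pos : ∀ {n} → Fin n → ℕ
pos i = suc (toℕ i)

-- The color k : Fin m stands for the root of unity exp (2π √-1 k / m).
record ColoredPermutation (m n : ℕ) : Set where
  constructor colored
  field
    σ : Permutation′ n
    k : Fin n → Fin m

open ColoredPermutation public

-- The underlying set of the wreath product; the group law plays no role here.
-- Equality has to be extensional, as both components contain functions.
𝕌_≀𝔖_ : ℕ → ℕ → Setoid 0ℓ 0ℓ
𝕌 m ≀𝔖 n = record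
  { Carrier       = ColoredPermutation m n
  ; _≈_           = λ π ρ → (σ π Perm.≈ σ ρ) × (k π ≗ k ρ)
  ; isEquivalence = record
    { refl  = (λ _ → refl) , (λ _ → refl)
    ; sym   = λ (e , f) → (λ i → sym (e i)) , (λ i → sym (f i))
    ; trans = λ (e , f) (e′ , f′) → (λ i → trans (e i) (e′ i)) , (λ i → trans (f i) (f′ i))
    }
  }

-- As 1 ≤ pos i ≤ n, the subtraction n ∸ pos i is not truncated.
pinvAt : ∀ {m n} → ColoredPermutation m n → Fin n → ℕ
pinvAt {n = n} π i =
  toℕ (k π i) ℕ.* (n ℕ.∸ pos i ℕ.+ 1) ℕ.+
  length (filter (λ j → (i <? j) ×-dec ((σ π ⟨$⟩ʳ j) <? (σ π ⟨$⟩ʳ i))) (allFin n))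

pinv : ∀ {m n} → ColoredPermutation m n → ℕ
pinv π = RawSemiringDefinitions.sum ℕ.+-*-rawSemiring (pinvAt π)

------------------------------------------------------------------------
-- Enumeration of the colored permutations

-- A permutation of suc n points is given by the image of the first point
-- and the permutation left after deleting that point and its image.
permutation : ∀ n → Fin (n !) → Permutation′ n
insertFirst : ∀ n → Fin (suc n) × Fin (n !) → Permutation′ (suc n)

permutation zero    _ = Perm.id
permutation (suc n) r = insertFirst n (remQuot (n !) r)

insertFirst n (i , r) = Perm.insert zero i (permutation n r)

rank : ∀ n → Permutation′ n → Fin (n !)
rank zero    _ = zero
rank (suc n) τ = combine (τ ⟨$⟩ʳ zero) (rank n (Perm.remove zero τ))

remove-cong : ∀ {n} (τ υ : Permutation′ (suc n)) → τ Perm.≈ υ →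
              Perm.remove zero τ Perm.≈ Perm.remove zero υ
remove-cong τ υ e j = punchIn-injective (υ ⟨$⟩ʳ zero) _ _ (begin
  punchIn (υ ⟨$⟩ʳ zero) (Perm.remove zero τ ⟨$⟩ʳ j)  ≡⟨ cong (λ x → punchIn x (Perm.remove zero τ ⟨$⟩ʳ j)) (e zero) ⟨
  punchIn (τ ⟨$⟩ʳ zero) (Perm.remove zero τ ⟨$⟩ʳ j)  ≡⟨ Perm.punchIn-permute τ zero j ⟨
  τ ⟨$⟩ʳ suc j                                       ≡⟨ e (suc j) ⟩
  υ ⟨$⟩ʳ suc j                                       ≡⟨ Perm.punchIn-permute υ zero j ⟩
  punchIn (υ ⟨$⟩ʳ zero) (Perm.remove zero υ ⟨$⟩ʳ j)  ∎)
  where open ≡-Reasoning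

insert-cong : ∀ {n} i (τ υ : Permutation′ n) → τ Perm.≈ υ →
              Perm.insert zero i τ Perm.≈ Perm.insert zero i υ
insert-cong i τ υ e zero    = refl
insert-cong i τ υ e (suc j) = cong (punchIn i) (e j)

rank-cong : ∀ n {τ υ : Permutation′ n} → τ Perm.≈ υ → rank n τ ≡ rank n υ
rank-cong zero    _         = refl
rank-cong (suc n) {τ} {υ} e = cong₂ combine (e zero) (rank-cong n {Perm.remove zero τ} {Perm.remove zero υ} (remove-cong τ υ e))

rank-permutation : ∀ n r → rank n (permutation n r) ≡ r
rank-permutation zero    zero = refl
rank-permutation (suc n) r    = trans
  (cong (combine (proj₁ ir)) (trans
    (rank-cong n {Perm.remove zero (insertFirst n ir)} {permutation n (proj₂ ir)}
      (Perm.remove-insert zero (proj₁ ir) (permutation n (proj₂ ir))))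
    (rank-permutation n (proj₂ ir))))
  (combine-remQuot {suc n} (n !) r)
  where ir = remQuot {suc n} (n !) r

permutation-rank : ∀ n τ → permutation n (rank n τ) Perm.≈ τ
permutation-rank zero    τ ()
permutation-rank (suc n) τ j = begin
  insertFirst n (remQuot (n !) (combine i r)) ⟨$⟩ʳ j  ≡⟨ cong (λ ir → insertFirst n ir ⟨$⟩ʳ j) (remQuot-combine i r) ⟩
  Perm.insert zero i (permutation n r) ⟨$⟩ʳ j         ≡⟨ insert-cong i (permutation n r) τ′ (permutation-rank n τ′) j ⟩
  Perm.insert zero i τ′ ⟨$⟩ʳ j                        ≡⟨ Perm.insert-remove zero τ j ⟩
  τ ⟨$⟩ʳ j                                            ∎
  where
  open ≡-Reasoning
  τ′ = Perm.remove zero τ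
  i  = τ ⟨$⟩ʳ zero
  r  = rank n τ′

funToFin-cong : ∀ {m n} {f g : Fin n → Fin m} → f ≗ g → funToFin f ≡ funToFin g
funToFin-cong {n = zero}  _ = refl
funToFin-cong {n = suc n} e = cong₂ combine (e zero) (funToFin-cong (e ∘ suc))

enumeration : ∀ m n → Inverse (setoid (Fin (n ! ℕ.* m ℕ.^ n))) (𝕌 m ≀𝔖 n)
enumeration m n = record
  { to        = to
  ; from      = from
  ; to-cong   = λ { refl → (λ _ → refl) , (λ _ → refl) }
  ; from-cong = λ {π} {ρ} → from-cong {π} {ρ}
  ; inverse   = (λ { {π} refl → to-from π })
              , (λ {x} {π} e → trans (from-cong {π} {to x} e) (from-to x))
  }
  where
  decode : Fin (n !) × Fin (m ℕ.^ n) → ColoredPermutation m n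
  decode (r , c) = colored (permutation n r) (finToFun c)

  to : Fin (n ! ℕ.* m ℕ.^ n) → ColoredPermutation m n
  to x = decode (remQuot (m ℕ.^ n) x)

  from : ColoredPermutation m n → Fin (n ! ℕ.* m ℕ.^ n)
  from π = combine (rank n (σ π)) (funToFin (k π))

  from-cong : ∀ {π ρ} → Setoid._≈_ (𝕌 m ≀𝔖 n) π ρ → from π ≡ from ρ
  from-cong {π} {ρ} (e , f) = cong₂ combine (rank-cong n {σ π} {σ ρ} e) (funToFin-cong f)

  from-to : ∀ x → from (to x) ≡ x
  from-to x = trans
    (cong₂ combine (rank-permutation n (proj₁ rc)) (funToFin-finToFin {n} {m} (proj₂ rc)))
    (combine-remQuot {n !} (m ℕ.^ n) x)
    where rc = remQuot {n !} (m ℕ.^ n) x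

  to-from : ∀ π → Setoid._≈_ (𝕌 m ≀𝔖 n) (to (from π)) π
  to-from π = (λ i → trans (cong (λ rc → σ (decode rc) ⟨$⟩ʳ i) to∘from) (permutation-rank n (σ π) i))
            , (λ i → trans (cong (λ rc → k (decode rc) i) to∘from) (finToFun-funToFin (k π) i))
    where to∘from = remQuot-combine (rank n (σ π)) (funToFin (k π))

-- As enumeration is a bijection, every colored permutation occurs exactly once.
∑[π∈𝕌_≀𝔖_] : ∀ m n → (ColoredPermutation m n → Polynomial) → Polynomial
∑[π∈𝕌 m ≀𝔖 n ] f = ℤ[q].sum (f ∘ Inverse.to (enumeration m n))

{-# OPTIONS --safe #-}

-- Deleting the first letter of π leaves a coloured permutation of n - 1
-- letters with the same pseudoinversions at the remaining positions, while the
-- first position contributes k₁ n + (σ(1) - 1).  As (k₁ , σ(1)) ranges over all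
-- pairs this runs once through 0, …, m n - 1, which gives the factor [m n]_q.

module Submission where

open import Defs
open import Data.Nat.Base using (ℕ; _≥_; _*_)

open import Algebra.Bundles using (CommutativeMonoid; Semiring)
import Algebra.Definitions.RawSemiring as RawSemiringDefinitions
import Algebra.Properties.CommutativeMonoid.Sum as CommutativeMonoidSum
import Algebra.Properties.CommutativeSemigroup as CommutativeSemigroupProperties
import Algebra.Properties.Monoid.Sum as MonoidSum
import Algebra.Properties.Semiring.Exp as SemiringExp
import Algebra.Properties.Semiring.Sum as SemiringSum
open import Algebra.Structures using (IsCommutativeMonoid; IsSemiring)
open import Data.Bool.Base using (Bool; true; false; if_then_else_; _∧_)
open import Data.Fin.Base using (Fin; zero; suc; toℕ; fromℕ; inject₁; punchIn; combine; remQuot; finToFun; _↑ˡ_; _↑ʳ_)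
open import Data.Fin.Permutation as Perm using (Permutation′; _⟨$⟩ʳ_)
open import Data.Fin.Properties using (_<?_; remQuot-combine; toℕ-combine; toℕ-fromℕ; toℕ-inject₁)
open import Data.Integer.Base as ℤ using (ℤ; 0ℤ; 1ℤ)
import Data.Integer.Properties as ℤ
open import Data.List.Base using ([]; _∷_; filter; length; map; tabulate)
open import Data.Nat.Base as ℕ using (zero; suc; _<ᵇ_; _!)
import Data.Nat.Properties as ℕ
open import Data.Product.Base using (_×_; _,_; proj₂)
open import Function.Base using (_∘_)
open import Level using (0ℓ)
open import Relation.Binary.PropositionalEquality as ≡ using (_≡_; refl; cong; cong₂)
import Relation.Binary.Reasoning.Setoid as SetoidReasoning
open import Relation.Binary.Structures using (IsEquivalence)
open import Relation.Nullary.Decidable using (does; _×-dec_)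
open import Relation.Unary using (Pred; Decidable)

-- The semiring ℤ[q]

infix 4 _≋_

-- p ≈ₚ r unfolds to a function type from which p and r cannot be inferred;
-- the record keeps them visible to unification.
record _≋_ (p r : Polynomial) : Set where
  constructor coeffwise
  field
    coeff-≡ : p ≈ₚ r

open _≋_

≋-isEquivalence : IsEquivalence _≋_
≋-isEquivalence = record
  { refl  = coeffwise λ _ → refl
  ; sym   = λ e → coeffwise λ k → ≡.sym (coeff-≡ e k)
  ; trans = λ e f → coeffwise λ k → ≡.trans (coeff-≡ e k) (coeff-≡ f k)
  }

open IsEquivalence ≋-isEquivalence using ()
  renaming (refl to ≋-refl; sym to ≋-sym)

∷-cong : ∀ {a b p r} → a ≡ b → p ≋ r → (a ∷ p) ≋ (b ∷ r)
∷-cong a≡b p≋r = coeffwise λ where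
  zero    → a≡b
  (suc k) → coeff-≡ p≋r k

0∷≋[] : ∀ {p} → p ≋ [] → (0ℤ ∷ p) ≋ []
0∷≋[] p≋[] = coeffwise λ where
  zero    → refl
  (suc k) → coeff-≡ p≋[] k

∷≋[]⇒tail≋[] : ∀ {a p} → (a ∷ p) ≋ [] → p ≋ []
∷≋[]⇒tail≋[] e = coeffwise (coeff-≡ e ∘ suc)

∷-injectiveʳ : ∀ {a b p r} → (a ∷ p) ≋ (b ∷ r) → p ≋ r
∷-injectiveʳ e = coeffwise (coeff-≡ e ∘ suc)

-- Addition of polynomials

coeff-+ₚ : ∀ p r k → coeff (p +ₚ r) k ≡ coeff p k ℤ.+ coeff r k
coeff-+ₚ []      r       k       = ≡.sym (ℤ.+-identityˡ _)
coeff-+ₚ (a ∷ p) []      k       = ≡.sym (ℤ.+-identityʳ _)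
coeff-+ₚ (a ∷ p) (b ∷ r) zero    = refl
coeff-+ₚ (a ∷ p) (b ∷ r) (suc k) = coeff-+ₚ p r k

+ₚ-cong : ∀ {p p′ r r′} → p ≋ p′ → r ≋ r′ → p +ₚ r ≋ p′ +ₚ r′
+ₚ-cong {p} {p′} {r} {r′} e f = coeffwise λ k → begin
  coeff (p +ₚ r) k           ≡⟨ coeff-+ₚ p r k ⟩
  coeff p k ℤ.+ coeff r k    ≡⟨ cong₂ ℤ._+_ (coeff-≡ e k) (coeff-≡ f k) ⟩
  coeff p′ k ℤ.+ coeff r′ k  ≡⟨ coeff-+ₚ p′ r′ k ⟨
  coeff (p′ +ₚ r′) k         ∎
  where open ≡.≡-Reasoning

+ₚ-comm : ∀ p r → p +ₚ r ≋ r +ₚ p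
+ₚ-comm []      []      = ≋-refl
+ₚ-comm []      (b ∷ r) = ≋-refl
+ₚ-comm (a ∷ p) []      = ≋-refl
+ₚ-comm (a ∷ p) (b ∷ r) = ∷-cong (ℤ.+-comm a b) (+ₚ-comm p r)

+ₚ-assoc : ∀ p r s → (p +ₚ r) +ₚ s ≋ p +ₚ (r +ₚ s)
+ₚ-assoc []      r       s       = ≋-refl
+ₚ-assoc (a ∷ p) []      s       = ≋-refl
+ₚ-assoc (a ∷ p) (b ∷ r) []      = ≋-refl
+ₚ-assoc (a ∷ p) (b ∷ r) (c ∷ s) = ∷-cong (ℤ.+-assoc a b c) (+ₚ-assoc p r s)

+ₚ-identityʳ : ∀ p → p +ₚ [] ≋ p
+ₚ-identityʳ []      = ≋-refl
+ₚ-identityʳ (a ∷ p) = ≋-refl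

+ₚ-isCommutativeMonoid : IsCommutativeMonoid _≋_ _+ₚ_ []
+ₚ-isCommutativeMonoid = record
  { isMonoid = record
    { isSemigroup = record
      { isMagma = record { isEquivalence = ≋-isEquivalence ; ∙-cong = +ₚ-cong }
      ; assoc   = +ₚ-assoc
      }
    ; identity = (λ _ → ≋-refl) , +ₚ-identityʳ
    }
  ; comm = +ₚ-comm
  }

+ₚ-commutativeMonoid : CommutativeMonoid 0ℓ 0ℓ
+ₚ-commutativeMonoid = record { isCommutativeMonoid = +ₚ-isCommutativeMonoid }

module ≋-Reasoning = SetoidReasoning (CommutativeMonoid.setoid +ₚ-commutativeMonoid)
open CommutativeSemigroupProperties (CommutativeMonoid.commutativeSemigroup +ₚ-commutativeMonoid)
  using () renaming (interchange to +ₚ-interchange)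

-- Scalar multiples of polynomials

infixr 8 _·_

_·_ : ℤ → Polynomial → Polynomial
a · p = map (a ℤ.*_) p

coeff-· : ∀ a p k → coeff (a · p) k ≡ a ℤ.* coeff p k
coeff-· a []      k       = ≡.sym (ℤ.*-zeroʳ a)
coeff-· a (b ∷ p) zero    = refl
coeff-· a (b ∷ p) (suc k) = coeff-· a p k

·-cong : ∀ a {p r} → p ≋ r → a · p ≋ a · r
·-cong a {p} {r} e = coeffwise λ k → begin
  coeff (a · p) k  ≡⟨ coeff-· a p k ⟩
  a ℤ.* coeff p k  ≡⟨ cong (a ℤ.*_) (coeff-≡ e k) ⟩
  a ℤ.* coeff r k  ≡⟨ coeff-· a r k ⟨
  coeff (a · r) k  ∎
  where open ≡.≡-Reasoning

·-distribˡ : ∀ a p r → a · (p +ₚ r) ≋ a · p +ₚ a · r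
·-distribˡ a []      r       = ≋-refl
·-distribˡ a (b ∷ p) []      = ≋-refl
·-distribˡ a (b ∷ p) (c ∷ r) = ∷-cong (ℤ.*-distribˡ-+ a b c) (·-distribˡ a p r)

·-distribʳ : ∀ a b p → (a ℤ.+ b) · p ≋ a · p +ₚ b · p
·-distribʳ a b []      = ≋-refl
·-distribʳ a b (c ∷ p) = ∷-cong (ℤ.*-distribʳ-+ c a b) (·-distribʳ a b p)

·-assoc : ∀ a b p → (a ℤ.* b) · p ≋ a · b · p
·-assoc a b []      = ≋-refl
·-assoc a b (c ∷ p) = ∷-cong (ℤ.*-assoc a b c) (·-assoc a b p)

·-identity : ∀ p → 1ℤ · p ≋ p
·-identity []      = ≋-refl
·-identity (a ∷ p) = ∷-cong (ℤ.*-identityˡ a) (·-identity p)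

·-zero : ∀ p → 0ℤ · p ≋ []
·-zero []      = ≋-refl
·-zero (a ∷ p) = 0∷≋[] (·-zero p)

-- Products of polynomials

*ₚ-distribʳ : ∀ s p r → (p +ₚ r) *ₚ s ≋ p *ₚ s +ₚ r *ₚ s
*ₚ-distribʳ s []      r       = ≋-refl
*ₚ-distribʳ s (a ∷ p) []      = ≋-sym (+ₚ-identityʳ ((a ∷ p) *ₚ s))
*ₚ-distribʳ s (a ∷ p) (b ∷ r) = begin
  (a ℤ.+ b) · s +ₚ (0ℤ ∷ (p +ₚ r) *ₚ s)
    ≈⟨ +ₚ-cong (·-distribʳ a b s) (∷-cong refl (*ₚ-distribʳ s p r)) ⟩
  (a · s +ₚ b · s) +ₚ ((0ℤ ∷ p *ₚ s) +ₚ (0ℤ ∷ r *ₚ s))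
    ≈⟨ +ₚ-interchange (a · s) (b · s) (0ℤ ∷ p *ₚ s) (0ℤ ∷ r *ₚ s) ⟩
  (a ∷ p) *ₚ s +ₚ (b ∷ r) *ₚ s ∎
  where open ≋-Reasoning

*ₚ-distribˡ : ∀ p r s → p *ₚ (r +ₚ s) ≋ p *ₚ r +ₚ p *ₚ s
*ₚ-distribˡ []      r s = ≋-refl
*ₚ-distribˡ (a ∷ p) r s = begin
  a · (r +ₚ s) +ₚ (0ℤ ∷ p *ₚ (r +ₚ s))
    ≈⟨ +ₚ-cong (·-distribˡ a r s) (∷-cong refl (*ₚ-distribˡ p r s)) ⟩
  (a · r +ₚ a · s) +ₚ ((0ℤ ∷ p *ₚ r) +ₚ (0ℤ ∷ p *ₚ s))
    ≈⟨ +ₚ-interchange (a · r) (a · s) (0ℤ ∷ p *ₚ r) (0ℤ ∷ p *ₚ s) ⟩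
  (a ∷ p) *ₚ r +ₚ (a ∷ p) *ₚ s ∎
  where open ≋-Reasoning

*ₚ-zeroʳ : ∀ p → p *ₚ [] ≋ []
*ₚ-zeroʳ []      = ≋-refl
*ₚ-zeroʳ (a ∷ p) = 0∷≋[] (*ₚ-zeroʳ p)

0∷-*ₚ : ∀ p r → (0ℤ ∷ p) *ₚ r ≋ (0ℤ ∷ p *ₚ r)
0∷-*ₚ p r = +ₚ-cong (·-zero r) ≋-refl

·-*ₚ : ∀ a p r → (a · p) *ₚ r ≋ a · (p *ₚ r)
·-*ₚ a []      r = ≋-refl
·-*ₚ a (b ∷ p) r = begin
  (a ℤ.* b) · r +ₚ (0ℤ ∷ (a · p) *ₚ r)
    -- The leading `0ℤ` is rewritten as `a ℤ.* 0ℤ`, which makes the shifted tail a scalar multiple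
    -- by `a` as well.
    ≈⟨ +ₚ-cong (·-assoc a b r) (∷-cong (≡.sym (ℤ.*-zeroʳ a)) (·-*ₚ a p r)) ⟩
  a · b · r +ₚ a · (0ℤ ∷ p *ₚ r)
    ≈⟨ ·-distribˡ a (b · r) (0ℤ ∷ p *ₚ r) ⟨
  a · ((b ∷ p) *ₚ r) ∎
  where open ≋-Reasoning

*ₚ-assoc : ∀ p r s → (p *ₚ r) *ₚ s ≋ p *ₚ (r *ₚ s)
*ₚ-assoc []      r s = ≋-refl
*ₚ-assoc (a ∷ p) r s = begin
  (a · r +ₚ (0ℤ ∷ p *ₚ r)) *ₚ s
    ≈⟨ *ₚ-distribʳ s (a · r) (0ℤ ∷ p *ₚ r) ⟩
  (a · r) *ₚ s +ₚ (0ℤ ∷ p *ₚ r) *ₚ s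
    ≈⟨ +ₚ-cong (·-*ₚ a r s) (0∷-*ₚ (p *ₚ r) s) ⟩
  a · (r *ₚ s) +ₚ (0ℤ ∷ (p *ₚ r) *ₚ s)
    ≈⟨ +ₚ-cong ≋-refl (∷-cong refl (*ₚ-assoc p r s)) ⟩
  (a ∷ p) *ₚ (r *ₚ s) ∎
  where open ≋-Reasoning

*ₚ-identityˡ : ∀ p → (1ℤ ∷ []) *ₚ p ≋ p
*ₚ-identityˡ p = begin
  1ℤ · p +ₚ (0ℤ ∷ [])  ≈⟨ +ₚ-cong (·-identity p) (0∷≋[] ≋-refl) ⟩
  p +ₚ []              ≈⟨ +ₚ-identityʳ p ⟩
  p                    ∎
  where open ≋-Reasoning

*ₚ-identityʳ : ∀ p → p *ₚ (1ℤ ∷ []) ≋ p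
*ₚ-identityʳ []      = ≋-refl
*ₚ-identityʳ (a ∷ p) =
  ∷-cong (≡.trans (ℤ.+-identityʳ _) (ℤ.*-identityʳ a)) (*ₚ-identityʳ p)

*ₚ-congˡ : ∀ p {r s} → r ≋ s → p *ₚ r ≋ p *ₚ s
*ₚ-congˡ []      e = ≋-refl
*ₚ-congˡ (a ∷ p) e = +ₚ-cong (·-cong a e) (∷-cong refl (*ₚ-congˡ p e))

-- A list of zeros of any length represents the zero polynomial. This covers the cases of `*ₚ-congʳ`
-- where one of the two equal left factors is a longer list than the other.
≋[]⇒*ₚ≋[] : ∀ p r → p ≋ [] → p *ₚ r ≋ []
≋[]⇒*ₚ≋[] []      r e = ≋-refl
≋[]⇒*ₚ≋[] (a ∷ p) r e with refl ← coeff-≡ e zero = begin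
  (0ℤ ∷ p) *ₚ r  ≈⟨ 0∷-*ₚ p r ⟩
  (0ℤ ∷ p *ₚ r)  ≈⟨ 0∷≋[] (≋[]⇒*ₚ≋[] p r (∷≋[]⇒tail≋[] e)) ⟩
  []             ∎
  where open ≋-Reasoning

*ₚ-congʳ : ∀ s {p r} → p ≋ r → p *ₚ s ≋ r *ₚ s
*ₚ-congʳ s {[]}    {r}     e = ≋-sym (≋[]⇒*ₚ≋[] r s (≋-sym e))
*ₚ-congʳ s {a ∷ p} {[]}    e = ≋[]⇒*ₚ≋[] (a ∷ p) s e
*ₚ-congʳ s {a ∷ p} {b ∷ r} e with refl ← coeff-≡ e zero =
  +ₚ-cong ≋-refl (∷-cong refl (*ₚ-congʳ s (∷-injectiveʳ e)))

*ₚ-cong : ∀ {p p′ r r′} → p ≋ p′ → r ≋ r′ → p *ₚ r ≋ p′ *ₚ r′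
*ₚ-cong {p} {p′} {r} {r′} e f = begin
  p *ₚ r    ≈⟨ *ₚ-congˡ p f ⟩
  p *ₚ r′   ≈⟨ *ₚ-congʳ r′ e ⟩
  p′ *ₚ r′  ∎
  where open ≋-Reasoning

-- Powers are parametrised by the raw semiring, equality included, and do not
-- reduce for variable exponents, so the bundle must carry _≈ₚ_ itself, not _≋_.
ℤ[q]-isSemiring : IsSemiring _≈ₚ_ _+ₚ_ _*ₚ_ [] (1ℤ ∷ [])
ℤ[q]-isSemiring = record
  { isSemiringWithoutAnnihilatingZero = record
    { +-isCommutativeMonoid = record
      { isMonoid = record
        { isSemigroup = record
          { isMagma = record
            { isEquivalence = record
              { refl  = λ _ → refl
              ; sym   = λ e k → ≡.sym (e k)
              ; trans = λ e f k → ≡.trans (e k) (f k)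
              }
            ; ∙-cong = λ {p} {p′} {r} {r′} e f → coeff-≡ (+ₚ-cong {p} {p′} {r} {r′} (coeffwise e) (coeffwise f))
            }
          ; assoc = λ p r s → coeff-≡ (+ₚ-assoc p r s)
          }
        ; identity = (λ _ _ → refl) , (λ p → coeff-≡ (+ₚ-identityʳ p))
        }
      ; comm = λ p r → coeff-≡ (+ₚ-comm p r)
      }
    ; *-cong     = λ {p} {p′} {r} {r′} e f → coeff-≡ (*ₚ-cong {p} {p′} {r} {r′} (coeffwise e) (coeffwise f))
    ; *-assoc    = λ p r s → coeff-≡ (*ₚ-assoc p r s)
    ; *-identity = (λ p → coeff-≡ (*ₚ-identityˡ p)) , (λ p → coeff-≡ (*ₚ-identityʳ p))
    ; distrib    = (λ p r s → coeff-≡ (*ₚ-distribˡ p r s)) , (λ s p r → coeff-≡ (*ₚ-distribʳ s p r))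
    }
  ; zero = (λ _ _ → refl) , (λ p → coeff-≡ (*ₚ-zeroʳ p))
  }

ℤ[q]-semiring : Semiring 0ℓ 0ℓ
ℤ[q]-semiring = record { isSemiring = ℤ[q]-isSemiring }

-- Pseudoinversions after deletion of the first letter

module ℕΣ = CommutativeMonoidSum ℕ.+-0-commutativeMonoid

𝟙 : Bool → ℕ
𝟙 b = if b then 1 else 0

-- Counting by a sum over `Fin n` gives access to the invariance of sums under permutation of the
-- indices.
length-filter-tabulate : ∀ {a p} {A : Set a} {P : Pred A p} (P? : Decidable P) {n} (f : Fin n → A) →
  length (filter P? (tabulate f)) ≡ ℕΣ.sum (λ i → 𝟙 (does (P? (f i))))
length-filter-tabulate P? {zero}  f = refl
length-filter-tabulate P? {suc n} f with does (P? (f zero))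
... | true  = cong suc (length-filter-tabulate P? (f ∘ suc))
... | false = length-filter-tabulate P? (f ∘ suc)

-- `punchIn i` is strictly increasing.
punchIn-<ᵇ : ∀ {n} (i : Fin (suc n)) j k → (toℕ (punchIn i j) <ᵇ toℕ (punchIn i k)) ≡ (toℕ j <ᵇ toℕ k)
punchIn-<ᵇ zero    j       k       = refl
punchIn-<ᵇ (suc i) zero    zero    = refl
punchIn-<ᵇ (suc i) zero    (suc k) = refl
punchIn-<ᵇ (suc i) (suc j) zero    = refl
punchIn-<ᵇ (suc i) (suc j) (suc k) = punchIn-<ᵇ i j k

-- `punchIn i` fixes the values below `i` and moves all others above `i`.
punchIn-<ᵇ-pivot : ∀ {n} (i : Fin (suc n)) j → (toℕ (punchIn i j) <ᵇ toℕ i) ≡ (toℕ j <ᵇ toℕ i)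
punchIn-<ᵇ-pivot zero    j       = refl
punchIn-<ᵇ-pivot (suc i) zero    = refl
punchIn-<ᵇ-pivot (suc i) (suc j) = punchIn-<ᵇ-pivot i j

-- Since `toℕ i` is at most `n`, all the numbers below it occur in `Fin n`.
count-below : ∀ {n} (i : Fin (suc n)) → ℕΣ.sum {n} (λ j → 𝟙 (toℕ j <ᵇ toℕ i)) ≡ toℕ i
count-below {zero}  zero    = refl
count-below {suc n} zero    = count-below {n} zero
count-below {suc n} (suc i) = cong suc (count-below i)

-- The Boolean conjunction is what `does` of the decision procedure in `pinvAt` reduces to.
inversionsAt : ∀ {n} → Permutation′ n → Fin n → ℕ
inversionsAt τ i = ℕΣ.sum (λ j → 𝟙 ((toℕ i <ᵇ toℕ j) ∧ (toℕ (τ ⟨$⟩ʳ j) <ᵇ toℕ (τ ⟨$⟩ʳ i))))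

inversionsAt-insert-zero : ∀ {n} i (τ : Permutation′ n) → inversionsAt (Perm.insert zero i τ) zero ≡ toℕ i
inversionsAt-insert-zero {n} i τ = begin
  -- The summand of position `zero` itself reduces to 0, and every other position lies to its right,
  -- so only the comparison of images is left.
  ℕΣ.sum (λ j → 𝟙 (toℕ (punchIn i (τ ⟨$⟩ʳ j)) <ᵇ toℕ i))  ≡⟨ ℕΣ.sum-cong-≗ (λ j → cong 𝟙 (punchIn-<ᵇ-pivot i (τ ⟨$⟩ʳ j))) ⟩
  ℕΣ.sum (λ j → 𝟙 (toℕ (τ ⟨$⟩ʳ j) <ᵇ toℕ i))              ≡⟨ ℕΣ.sum-permute (λ j → 𝟙 (toℕ j <ᵇ toℕ i)) τ ⟨
  ℕΣ.sum {n} (λ j → 𝟙 (toℕ j <ᵇ toℕ i))                   ≡⟨ count-below i ⟩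
  toℕ i                                                   ∎
  where open ≡.≡-Reasoning

-- The inserted letter stands to the left of position `suc j`, so it is not counted, and the other
-- images keep their relative order.
inversionsAt-insert-suc : ∀ {n} i (τ : Permutation′ n) j → inversionsAt (Perm.insert zero i τ) (suc j) ≡ inversionsAt τ j
inversionsAt-insert-suc i τ j =
  ℕΣ.sum-cong-≗ (λ l → cong (λ b → 𝟙 ((toℕ j <ᵇ toℕ l) ∧ b)) (punchIn-<ᵇ i (τ ⟨$⟩ʳ l) (τ ⟨$⟩ʳ j)))

pinvAt-inversionsAt : ∀ {m n} (π : ColoredPermutation m n) i →
  pinvAt π i ≡ toℕ (k π i) * (n ℕ.∸ pos i ℕ.+ 1) ℕ.+ inversionsAt (σ π) i
pinvAt-inversionsAt {n = n} π i = cong (λ l → toℕ (k π i) * (n ℕ.∸ pos i ℕ.+ 1) ℕ.+ l)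
  (length-filter-tabulate (λ j → (i <? j) ×-dec ((σ π ⟨$⟩ʳ j) <? (σ π ⟨$⟩ʳ i))) (λ j → j))

pinv-insert : ∀ {m n} i (τ : Permutation′ n) (c : Fin (suc n) → Fin m) →
  pinv (colored (Perm.insert zero i τ) c) ≡ pinv (colored τ (c ∘ suc)) ℕ.+ toℕ (combine (c zero) i)
-- The new exponent is moved to the right because the factor it produces will be the last one of the
-- product, and multiplication is not assumed commutative.
pinv-insert {m} {n} i τ c = ≡.trans (cong₂ ℕ._+_ first (ℕΣ.sum-cong-≗ rest)) (ℕ.+-comm (toℕ (combine (c zero) i)) _)
  where
  open ≡.≡-Reasoning

  π : ColoredPermutation m (suc n)
  π = colored (Perm.insert zero i τ) c

  first : pinvAt π zero ≡ toℕ (combine (c zero) i)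
  first = begin
    pinvAt π zero                                          ≡⟨ pinvAt-inversionsAt π zero ⟩
    toℕ (c zero) * (n ℕ.+ 1) ℕ.+ inversionsAt (σ π) zero   ≡⟨ cong₂ ℕ._+_ (cong (toℕ (c zero) *_) (ℕ.+-comm n 1)) (inversionsAt-insert-zero i τ) ⟩
    toℕ (c zero) * suc n ℕ.+ toℕ i                         ≡⟨ cong (ℕ._+ toℕ i) (ℕ.*-comm (toℕ (c zero)) (suc n)) ⟩
    suc n * toℕ (c zero) ℕ.+ toℕ i                         ≡⟨ toℕ-combine (c zero) i ⟨
    toℕ (combine (c zero) i)                               ∎

  rest : ∀ j → pinvAt π (suc j) ≡ pinvAt (colored τ (c ∘ suc)) j
  rest j = begin
    pinvAt π (suc j)                  ≡⟨ pinvAt-inversionsAt π (suc j) ⟩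
    w ℕ.+ inversionsAt (σ π) (suc j)  ≡⟨ cong (w ℕ.+_) (inversionsAt-insert-suc i τ j) ⟩
    w ℕ.+ inversionsAt τ j            ≡⟨ pinvAt-inversionsAt (colored τ (c ∘ suc)) j ⟨
    pinvAt (colored τ (c ∘ suc)) j    ∎
    -- `suc n ℕ.∸ pos (suc j)` reduces to `n ℕ.∸ pos j`: the number of letters from this position
    -- onwards is unchanged by the deletion.
    where w = toℕ (c (suc j)) * (n ℕ.∸ pos j ℕ.+ 1)

-- Generating functions over a semiring

module _ {a ℓ} (M : CommutativeMonoid a ℓ) where
  open CommutativeMonoid M hiding (refl)
  open CommutativeMonoidSum M

  sum-↑ : ∀ m {n} (f : Fin (m ℕ.+ n) → Carrier) →
    sum f ≈ sum (λ i → f (i ↑ˡ n)) ∙ sum (λ j → f (m ↑ʳ j))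
  sum-↑ zero    f = sym (identityˡ _)
  sum-↑ (suc m) f = trans (∙-congˡ (sum-↑ m (f ∘ suc))) (sym (assoc _ _ _))

  -- `combine` lays out the pairs in `m` consecutive blocks of length `n`, one for each first
  -- component.
  sum-combine : ∀ m {n} (f : Fin (m * n) → Carrier) →
    sum f ≈ ∑[ i < m ] ∑[ j < n ] f (combine i j)
  sum-combine zero        f = reflexive refl
  sum-combine (suc m) {n} f = trans (sum-↑ n f) (∙-congˡ (sum-combine m (λ i → f (n ↑ʳ i))))

  sum-remQuot : ∀ m {n} (f : Fin m × Fin n → Carrier) →
    sum (f ∘ remQuot {m} n) ≈ ∑[ i < m ] ∑[ j < n ] f (i , j)
  sum-remQuot m {n} f = trans (sum-combine m (f ∘ remQuot n))
    (reflexive (sum-cong-≗ (λ i → sum-cong-≗ (λ j → cong f (remQuot-combine i j)))))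

module _ {a ℓ} (S : Semiring a ℓ) where
  open Semiring S using (Carrier; _≈_; setoid; sym; trans; +-identityʳ; *-congˡ; *-congʳ; rawSemiring; +-commutativeMonoid; *-monoid)
    renaming (_*_ to infixl 7 _⊛_)
  open SemiringSum S
  open SemiringExp S
  open RawSemiringDefinitions rawSemiring using (product)
  open SetoidReasoning setoid

  sum²-cong : ∀ {m n} {f g : Fin m → Fin n → Carrier} → (∀ i j → f i j ≈ g i j) →
    ∑[ i < m ] ∑[ j < n ] f i j ≈ ∑[ i < m ] ∑[ j < n ] g i j
  sum²-cong e = sum-cong-≋ (λ i → sum-cong-≋ (e i))

  sum²-*ˡ : ∀ {m n} y (f : Fin m → Fin n → Carrier) →
    ∑[ i < m ] ∑[ j < n ] (y ⊛ f i j) ≈ y ⊛ ∑[ i < m ] ∑[ j < n ] f i j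
  sum²-*ˡ y f = sym (trans (*-distribˡ-sum y (λ i → sum (f i))) (sum-cong-≋ (λ i → *-distribˡ-sum y (f i))))

  sum²-*ʳ : ∀ {m n} y (f : Fin m → Fin n → Carrier) →
    ∑[ i < m ] ∑[ j < n ] (f i j ⊛ y) ≈ (∑[ i < m ] ∑[ j < n ] f i j) ⊛ y
  sum²-*ʳ y f = sym (trans (*-distribʳ-sum y (λ i → sum (f i))) (sum-cong-≋ (λ i → *-distribʳ-sum y (f i))))

  module _ (x : Carrier) where
    qInteger : ℕ → Carrier
    qInteger i = ∑[ j < i ] (x ^ toℕ j)

    -- Permutation codes and color codes are summed separately, so that the data of the first letter
    -- can be split off from each.
    pinvSum : ℕ → ℕ → Carrier
    pinvSum m n = ∑[ r < n ! ] ∑[ c < m ℕ.^ n ] (x ^ pinv (colored (permutation n r) (finToFun {m} c)))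

    pinvSum-suc : ∀ m n → pinvSum m (suc n) ≈ pinvSum m n ⊛ qInteger (m * suc n)
    pinvSum-suc m n = begin
      pinvSum m (suc n)
        ≈⟨ sum-remQuot +-commutativeMonoid (suc n) (λ ir → ∑[ c < m ℕ.^ suc n ] (x ^ pinv (colored (insertFirst n ir) (finToFun {m} c)))) ⟩
      ∑[ i < suc n ] ∑[ r < n ! ] ∑[ c < m ℕ.^ suc n ] (x ^ pinv (colored (insertFirst n (i , r)) (finToFun {m} c)))
        ≈⟨ sum²-cong (λ i r → sum-cong-≋ (λ c → split i r c)) ⟩
      ∑[ i < suc n ] ∑[ r < n ! ] ∑[ c < m ℕ.^ suc n ] term i r (remQuot (m ℕ.^ n) c)
        ≈⟨ sum²-cong (λ i r → sum-remQuot +-commutativeMonoid m (term i r)) ⟩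
      ∑[ i < suc n ] ∑[ r < n ! ] ∑[ c₀ < m ] ∑[ c < m ℕ.^ n ] (P r c ⊛ A c₀ i)
        -- With the sums over `r` and `c` innermost, `A c₀ i` is constant in them and factors out.
        ≈⟨ sum-cong-≋ (λ i → ∑-comm (λ r c₀ → ∑[ c < m ℕ.^ n ] (P r c ⊛ A c₀ i))) ⟩
      ∑[ i < suc n ] ∑[ c₀ < m ] ∑[ r < n ! ] ∑[ c < m ℕ.^ n ] (P r c ⊛ A c₀ i)
        ≈⟨ sum²-cong (λ i c₀ → sum²-*ʳ (A c₀ i) P) ⟩
      ∑[ i < suc n ] ∑[ c₀ < m ] (pinvSum m n ⊛ A c₀ i)
        ≈⟨ sum²-*ˡ (pinvSum m n) (λ i c₀ → A c₀ i) ⟩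
      pinvSum m n ⊛ ∑[ i < suc n ] ∑[ c₀ < m ] A c₀ i
        -- The color must be the outer index to match the block layout of `combine c₀ i`, which then
        -- runs once through all exponents below `m * suc n`.
        ≈⟨ *-congˡ (∑-comm (λ i c₀ → A c₀ i)) ⟩
      pinvSum m n ⊛ ∑[ c₀ < m ] ∑[ i < suc n ] A c₀ i
        ≈⟨ *-congˡ (sum-combine +-commutativeMonoid m (λ j → x ^ toℕ j)) ⟨
      pinvSum m n ⊛ qInteger (m * suc n) ∎
      where
      A : Fin m → Fin (suc n) → Carrier
      A c₀ i = x ^ toℕ (combine c₀ i)

      P : Fin (n !) → Fin (m ℕ.^ n) → Carrier
      P r c = x ^ pinv (colored (permutation n r) (finToFun {m} c))

      term : Fin (suc n) → Fin (n !) → Fin m × Fin (m ℕ.^ n) → Carrier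
      term i r (c₀ , c) = P r c ⊛ A c₀ i

      -- The quotient of the color code `c` is the first color and its remainder encodes the other
      -- colors, both by definition of `finToFun`.
      split : ∀ i r c → x ^ pinv (colored (insertFirst n (i , r)) (finToFun {m} c)) ≈ term i r (remQuot (m ℕ.^ n) c)
      split i r c = trans
        (^-congʳ x (pinv-insert i (permutation n r) (finToFun c)))
        (^-homo-* x (pinv (colored (permutation n r) (finToFun {m} (proj₂ (remQuot {m} (m ℕ.^ n) c))))) _)

    pinvSum-product : ∀ m n → pinvSum m n ≈ product {n} (λ i → qInteger (m * pos i))
    -- There is one empty permutation with one empty coloring, contributing `x ^ 0`; the empty
    -- product is likewise 1.
    pinvSum-product m zero    = trans (+-identityʳ _) (+-identityʳ _)
    pinvSum-product m (suc n) = begin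
      pinvSum m (suc n)
        ≈⟨ pinvSum-suc m n ⟩
      pinvSum m n ⊛ qInteger (m * suc n)
        ≈⟨ *-congʳ (pinvSum-product m n) ⟩
      product {n} (λ i → qInteger (m * pos i)) ⊛ qInteger (m * suc n)
        -- `product` unfolds from its first factor while the recursion supplies the last one, hence
        -- the indexing by `inject₁` and `fromℕ`.
        ≡⟨ cong₂ _⊛_
               (MonoidSum.sum-cong-≗ *-monoid {n} (λ i → cong (λ j → qInteger (m * suc j)) (toℕ-inject₁ i)))
               (cong (λ j → qInteger (m * suc j)) (toℕ-fromℕ n)) ⟨
      product {n} (λ i → qInteger (m * pos (inject₁ i))) ⊛ qInteger (m * pos (fromℕ n))
        ≈⟨ MonoidSum.sum-init-last *-monoid (λ i → qInteger (m * pos {suc n} i)) ⟨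
      product {suc n} (λ i → qInteger (m * pos i)) ∎

-- Specialization to the semiring of polynomials in `q`

corollary1p7 : (m n : ℕ) → m ≥ 1 → n ≥ 1 →
    ∑[π∈𝕌 m ≀𝔖 n ] (λ π → q ℤ[q].^ pinv π) ℤ[q].≈ ℤ[q].product {n} (λ i → [ m * pos i ]q)
corollary1p7 m n _ _ = begin
  ∑[π∈𝕌 m ≀𝔖 n ] (λ π → q ℤ[q].^ pinv π)
    ≈⟨ sum-remQuot +-commutativeMonoid (n !)
         (λ (r , c) → q ℤ[q].^ pinv (colored (permutation n r) (finToFun {m} c))) ⟩
  pinvSum ℤ[q]-semiring q m n
    ≈⟨ pinvSum-product ℤ[q]-semiring q m n ⟩
  ℤ[q].product {n} (λ i → [ m * pos i ]q) ∎
  where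
  open Semiring ℤ[q]-semiring using (+-commutativeMonoid; setoid)
  open SetoidReasoning setoid
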